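{- Let $\mathcal{V}$ be an arithmetical variety such that $\mathcal{V}_{FSI}$ is a universal class. The following are equivalent: (1) $\mathcal{V}$ has surjective epimorphisms. (2) For all $\mathbf{A},\mathbf{B}\in\mathcal{V}$, if $\mathbf{A}\leq_e\mathbf{B}$ in $\mathcal{V}$, then $\mathbf{A}=\mathbf{B}$. (3) For all $\mathbf{A},\mathbf{B}\in\mathcal{V}_{FSI}$, if $\mathbf{A}\leq_e\mathbf{B}$ in $\mathcal{V}_{FSI}$, then $\mathbf{A}=\mathbf{B}$. (4) $\mathcal{V}_{FSI}$ has surjective epimorphisms.
   Context: All languages are algebraic (no relation symbols); algebras are nonempty. A variety $\mathcal{V}$ is arithmetical if for every $\mathbf{A}\in\mathcal{V}$ the congruence lattice of $\mathbf{A}$ is distributive and the join of any two congruences is their composition. An algebra is finitely subdirectly irreducible if its diagonal congruence is meet irreducible in its congruence lattice (if the diagonal is $\alpha\cap\beta$ for congruences $\alpha,\beta$, then it equals $\alpha$ or $\beta$); $\mathcal{V}_{FSI}$ is the class of finitely subdirectly irreducible members of $\mathcal{V}$. A universal class is a class axiomatizable by universal first order sentences. For a class $\mathcal{K}$ and $\mathbf{A},\mathbf{B}\in\mathcal{K}$, $\mathbf{A}\leq_e\mathbf{B}$ in $\mathcal{K}$ means that $\mathbf{A}$ is a subalgebra of $\mathbf{B}$ and for every $\mathbf{C}\in\mathcal{K}$ and all homomorphisms $g,g':\mathbf{B}\to\mathbf{C}$ with $g|_A=g'|_A$ we have $g=g'$. For $\mathbf{A},\mathbf{B}\in\mathcal{K}$,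 a homomorphism $h:\mathbf{A}\to\mathbf{B}$ is a $\mathcal{K}$-epimorphism if for every $\mathbf{C}\in\mathcal{K}$ and homomorphisms $g,g':\mathbf{B}\to\mathbf{C}$, $gh=g'h$ implies $g=g'$. $\mathcal{K}$ has surjective epimorphisms if every $\mathcal{K}$-epimorphism (between members of $\mathcal{K}$) is surjective. -}

module Defs where

open import Level using (Level; _⊔_; suc)
open import Data.Nat.Base using (ℕ)
open import Data.Fin.Base using (Fin)
open import Data.Product.Base using (Σ; Σ-syntax; ∃-syntax; _×_; _,_; proj₁; proj₂; map; zip)
open import Data.Sum.Base using (_⊎_; inj₁; inj₂)
open import Data.Vec.Functional using (Vector)
open import Function.Base using (_∘_; id)
open import Function.Bundles using (Func; _⇔_)
open import Function.Definitions using (Surjective)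
open import Relation.Nullary.Negation.Core using (¬_)
open import Relation.Unary using (Pred; _∈_; _∩_)
open import Relation.Binary.Core using (Rel; _⇒_)
open import Relation.Binary.Definitions using (_Respects_)
open import Relation.Binary.Structures using (IsEquivalence)
open import Relation.Binary.Bundles using (Setoid)
open import Relation.Binary.Construct.Composition using (_;_)
open import Relation.Binary.Lattice.Bundles using (Lattice)
open import Relation.Binary.Lattice.Structures using (IsDistributiveLattice)

-- The axiom of choice for sets with their own equality: every surjection
-- of setoids has a section that respects equality. (The variant for bare
-- types, with no condition on equality, is already provable.)

AxiomOfChoice : (a ℓ₁ b ℓ₂ : Level) → Set (suc (a ⊔ ℓ₁ ⊔ b ⊔ ℓ₂))
AxiomOfChoice a ℓ₁ b ℓ₂ =
  (A : Setoid a ℓ₁) (B : Setoid b ℓ₂) (f : Func A B) →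
  Surjective (Setoid._≈_ A) (Setoid._≈_ B) (Func.to f) →
  Σ[ g ∈ Func B A ] (∀ y → Setoid._≈_ B (Func.to f (Func.to g y)) y)

record Signature (ℓ : Level) : Set (suc ℓ) where
  field
    Op    : Set ℓ
    arity : Op → ℕ

open Signature

-- Equality is that of a setoid, so that quotients by congruences exist.

record Algebra {ℓ} (𝓛 : Signature ℓ) : Set (suc ℓ) where
  field
    setoid : Setoid ℓ ℓ
  open Setoid setoid public
  field
    op       : (f : Op 𝓛) → Vector Carrier (arity 𝓛 f) → Carrier
    op-cong  : ∀ f {xs ys} → (∀ i → xs i ≈ ys i) → op f xs ≈ op f ys
    nonempty : Carrier

private
  variable
    ℓ κ : Level
    𝓛 : Signature ℓ

Class : Signature ℓ → (κ : Level) → Set (suc ℓ ⊔ suc κ)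
Class 𝓛 κ = Pred (Algebra 𝓛) κ

record Hom {𝓛 : Signature ℓ} (A B : Algebra 𝓛) : Set ℓ where
  private
    module A = Algebra A
    module B = Algebra B
  field
    func     : Func A.setoid B.setoid
  open Func func public using (to; cong)
  field
    preserve : ∀ f xs → to (A.op f xs) B.≈ B.op f (to ∘ xs)

record Subalgebra {𝓛 : Signature ℓ} (B : Algebra 𝓛) : Set (suc ℓ) where
  private
    module B = Algebra B
  field
    member    : Pred B.Carrier ℓ
    respects  : member Respects B._≈_
    closed    : ∀ f {xs} → (∀ i → xs i ∈ member) → B.op f xs ∈ member
    inhabited : ∃[ b ] b ∈ member

  algebra : Algebra 𝓛
  algebra = record
    { setoid = record
      { Carrier       = Σ B.Carrier member
      ; _≈_           = λ x y → proj₁ x B.≈ proj₁ y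
      ; isEquivalence = record { refl = B.refl ; sym = B.sym ; trans = B.trans }
      }
    ; op       = λ f xs → B.op f (proj₁ ∘ xs) , closed f (proj₂ ∘ xs)
    ; op-cong  = λ f → B.op-cong f
    ; nonempty = inhabited
    }

data Term (𝓛 : Signature ℓ) (n : ℕ) : Set ℓ where
  var : Fin n → Term 𝓛 n
  app : (f : Op 𝓛) → Vector (Term 𝓛 n) (arity 𝓛 f) → Term 𝓛 n

data QuantifierFree (𝓛 : Signature ℓ) (n : ℕ) : Set ℓ where
  _≐_     : (s t : Term 𝓛 n) → QuantifierFree 𝓛 n
  not     : QuantifierFree 𝓛 n → QuantifierFree 𝓛 n
  _and_   : (φ ψ : QuantifierFree 𝓛 n) → QuantifierFree 𝓛 n
  _or_    : (φ ψ : QuantifierFree 𝓛 n) → QuantifierFree 𝓛 n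

record Identity (𝓛 : Signature ℓ) : Set ℓ where
  field
    vars    : ℕ
    lhs rhs : Term 𝓛 vars

-- ∀ x₁ … xₙ. φ  with  n = vars  and  φ = matrix.

record UniversalSentence (𝓛 : Signature ℓ) : Set ℓ where
  field
    vars   : ℕ
    matrix : QuantifierFree 𝓛 vars

module _ {𝓛 : Signature ℓ} (A : Algebra 𝓛) where
  open Algebra A

  ⟦_⟧ : ∀ {n} → Term 𝓛 n → Vector Carrier n → Carrier
  ⟦ var i ⟧    ρ = ρ i
  ⟦ app f ts ⟧ ρ = op f (λ i → ⟦ ts i ⟧ ρ)

  Holds : ∀ {n} → QuantifierFree 𝓛 n → Vector Carrier n → Set ℓ
  Holds (s ≐ t)   ρ = ⟦ s ⟧ ρ ≈ ⟦ t ⟧ ρ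
  Holds (not φ)   ρ = ¬ Holds φ ρ
  Holds (φ and ψ) ρ = Holds φ ρ × Holds ψ ρ
  Holds (φ or ψ)  ρ = Holds φ ρ ⊎ Holds ψ ρ

  SatisfiesIdentity : Identity 𝓛 → Set ℓ
  SatisfiesIdentity e = ∀ ρ → ⟦ lhs ⟧ ρ ≈ ⟦ rhs ⟧ ρ
    where open Identity e

  SatisfiesUniversal : UniversalSentence 𝓛 → Set ℓ
  SatisfiesUniversal σ = ∀ ρ → Holds matrix ρ
    where open UniversalSentence σ

IsVariety : {𝓛 : Signature ℓ} → Class 𝓛 κ → Set (suc ℓ ⊔ κ)
IsVariety {ℓ} {_} {𝓛} 𝒱 = Σ[ E ∈ Pred (Identity 𝓛) ℓ ]
  (∀ A → A ∈ 𝒱 ⇔ (∀ e → e ∈ E → SatisfiesIdentity A e))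

IsUniversalClass : {𝓛 : Signature ℓ} → Class 𝓛 κ → Set (suc ℓ ⊔ κ)
IsUniversalClass {ℓ} {_} {𝓛} 𝒦 = Σ[ Φ ∈ Pred (UniversalSentence 𝓛) ℓ ]
  (∀ A → A ∈ 𝒦 ⇔ (∀ σ → σ ∈ Φ → SatisfiesUniversal A σ))

module _ {𝓛 : Signature ℓ} (A : Algebra 𝓛) where
  private
    module A = Algebra A

  record Congruence : Set (suc ℓ) where
    field
      rel           : Rel A.Carrier ℓ
      isEquivalence : IsEquivalence rel
      reflexive     : A._≈_ ⇒ rel
      compatible    : ∀ f {xs ys} → (∀ i → rel (xs i) (ys i)) →
                      rel (A.op f xs) (A.op f ys)

  open Congruence

  data Generated (R : Rel A.Carrier ℓ) : Rel A.Carrier ℓ where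
    base  : R ⇒ Generated R
    equal : A._≈_ ⇒ Generated R
    sym   : ∀ {x y} → Generated R x y → Generated R y x
    trans : ∀ {x y z} → Generated R x y → Generated R y z → Generated R x z
    comp  : ∀ f {xs ys} → (∀ i → Generated R (xs i) (ys i)) →
            Generated R (A.op f xs) (A.op f ys)

  Cg : Rel A.Carrier ℓ → Congruence
  Cg R = record
    { rel           = Generated R
    ; isEquivalence = record { refl = equal A.refl ; sym = sym ; trans = trans }
    ; reflexive     = equal
    ; compatible    = comp
    }

  Cg-least : ∀ {R} (γ : Congruence) → R ⇒ rel γ → Generated R ⇒ rel γ
  Cg-least γ R⇒γ (base r)    = R⇒γ r
  Cg-least γ R⇒γ (equal p)   = reflexive γ p
  Cg-least γ R⇒γ (sym p)     = IsEquivalence.sym (isEquivalence γ) (Cg-least γ R⇒γ p)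
  Cg-least γ R⇒γ (trans p q) =
    IsEquivalence.trans (isEquivalence γ) (Cg-least γ R⇒γ p) (Cg-least γ R⇒γ q)
  Cg-least γ R⇒γ (comp f ps) = compatible γ f (λ i → Cg-least γ R⇒γ (ps i))

  Δ : Congruence
  Δ = record
    { rel           = A._≈_
    ; isEquivalence = A.isEquivalence
    ; reflexive     = id
    ; compatible    = A.op-cong
    }

  _∧ᶜ_ : Congruence → Congruence → Congruence
  α ∧ᶜ β = record
    { rel           = λ x y → rel α x y × rel β x y
    ; isEquivalence = record
      { refl  = α.refl , β.refl
      ; sym   = map α.sym β.sym
      ; trans = zip α.trans β.trans
      }
    ; reflexive     = λ p → reflexive α p , reflexive β p
    ; compatible    = λ f ps → compatible α f (proj₁ ∘ ps) , compatible β f (proj₂ ∘ ps)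
    }
    where
    module α = IsEquivalence (isEquivalence α)
    module β = IsEquivalence (isEquivalence β)

  _∨ᶜ_ : Congruence → Congruence → Congruence
  α ∨ᶜ β = Cg (λ x y → rel α x y ⊎ rel β x y)

  Con : Lattice (suc ℓ) ℓ ℓ
  Con = record
    { Carrier   = Congruence
    ; _≈_       = λ α β → (∀ {x y} → rel α x y → rel β x y) ×
                          (∀ {x y} → rel β x y → rel α x y)
    ; _≤_       = λ α β → ∀ {x y} → rel α x y → rel β x y
    ; _∨_       = _∨ᶜ_
    ; _∧_       = _∧ᶜ_
    ; isLattice = record
      { isPartialOrder = record
        { isPreorder = record
          { isEquivalence = record
            { refl  = id , id
            ; sym   = λ (p , q) → q , p
            ; trans = λ (p , q) (p′ , q′) → p′ ∘ p , q ∘ q′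
            }
          ; reflexive = λ (p , _) → p
          ; trans     = λ p q → q ∘ p
          }
        ; antisym = λ p q → p , q
        }
      ; supremum = λ α β → base ∘ inj₁ , base ∘ inj₂ ,
          λ γ p q → Cg-least γ λ { (inj₁ r) → p r ; (inj₂ r) → q r }
      ; infimum = λ α β → proj₁ , proj₂ , λ γ p q r → p r , q r
      }
    }

  private
    module Con = Lattice Con

  CongruenceDistributive : Set (suc ℓ)
  CongruenceDistributive = IsDistributiveLattice Con._≈_ Con._≤_ Con._∨_ Con._∧_

  JoinIsComposition : Set (suc ℓ)
  JoinIsComposition = ∀ α β {x y} → rel (α Con.∨ β) x y ⇔ (rel α ; rel β) x y

  FinitelySubdirectlyIrreducible : Set (suc ℓ)
  FinitelySubdirectlyIrreducible =
    ∀ α β → Δ Con.≈ (α Con.∧ β) → (Δ Con.≈ α) ⊎ (Δ Con.≈ β)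

IsArithmetical : {𝓛 : Signature ℓ} → Class 𝓛 κ → Set (suc ℓ ⊔ κ)
IsArithmetical 𝒱 = ∀ A → A ∈ 𝒱 → CongruenceDistributive A × JoinIsComposition A

FSI : {𝓛 : Signature ℓ} → Class 𝓛 κ → Class 𝓛 (suc ℓ ⊔ κ)
FSI 𝒱 = 𝒱 ∩ FinitelySubdirectlyIrreducible

IsEpi : {𝓛 : Signature ℓ} → Class 𝓛 κ → {A B : Algebra 𝓛} → Hom A B → Set (suc ℓ ⊔ κ)
IsEpi 𝒦 {A} {B} h = ∀ C → C ∈ 𝒦 → (g g′ : Hom B C) →
  let open Algebra C using (_≈_) in
  (∀ a → Hom.to g (Hom.to h a) ≈ Hom.to g′ (Hom.to h a)) →
  ∀ b → Hom.to g b ≈ Hom.to g′ b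

HasSurjectiveEpis : {𝓛 : Signature ℓ} → Class 𝓛 κ → Set (suc ℓ ⊔ κ)
HasSurjectiveEpis 𝒦 = ∀ A B → A ∈ 𝒦 → B ∈ 𝒦 → (h : Hom A B) → IsEpi 𝒦 h →
  Surjective (Algebra._≈_ A) (Algebra._≈_ B) (Hom.to h)

-- A ≤ₑ B in 𝒦; membership of A and B in 𝒦 is assumed separately.

IsEpicSubalgebra : {𝓛 : Signature ℓ} → Class 𝓛 κ → (B : Algebra 𝓛) → Subalgebra B →
                   Set (suc ℓ ⊔ κ)
IsEpicSubalgebra 𝒦 B A = ∀ C → C ∈ 𝒦 → (g g′ : Hom B C) →
  let open Algebra C using (_≈_) in
  (∀ b → b ∈ Subalgebra.member A → Hom.to g b ≈ Hom.to g′ b) →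
  ∀ b → Hom.to g b ≈ Hom.to g′ b

EpicSubalgebrasTotal : {𝓛 : Signature ℓ} → Class 𝓛 κ → Set (suc ℓ ⊔ κ)
EpicSubalgebrasTotal 𝒦 = ∀ B (A : Subalgebra B) → Subalgebra.algebra A ∈ 𝒦 → B ∈ 𝒦 →
  IsEpicSubalgebra 𝒦 B A → ∀ b → b ∈ Subalgebra.member A

{-# OPTIONS --safe #-}
module Submission where

-- (3) ⇒ (2). Let A ≤ₑ B in 𝒱 and let Spec be the set of congruences θ of B with
-- B/θ finitely subdirectly irreducible; by Zorn's lemma they separate points.
-- By (3), A meets every class of every θ ∈ Spec. For θ, θ′ ∈ Spec and b ∈ B, the
-- join γ of their restrictions to A gives maps B → B/θ → A/γ and B → B/θ′ → A/γ
-- that agree on A, hence at b; as γ is a composition, a single a ∈ A satisfies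
-- a θ b and a θ′ b. Since FSI is universal, Spec is closed under ultraproducts, so
-- finitely many such a suffice for all pairs (θ , θ′). As in the Baker–Pixley
-- theorem, a majority term then merges them into a single a with a θ b for all
-- θ ∈ Spec, that is, a = b.

open import Defs
open import Level using (Level; _⊔_; Lift; lift) renaming (suc to lsuc)
open import Axiom.ExcludedMiddle using (ExcludedMiddle)
open import Data.Empty using (⊥-elim)
open import Data.Empty.Polymorphic using (⊥)
open import Data.Fin.Base using (Fin; zero; suc)
open import Data.Fin.Patterns using (0F; 1F; 2F)
open import Data.Fin.Properties using (∀-cons)
open import Data.List.Base using (List; []; _∷_; _++_; map)
open import Data.List.Membership.Propositional using () renaming (_∈_ to _∈ˡ_)
open import Data.List.Relation.Binary.Subset.Propositional using () renaming (_⊆_ to _⊆ˡ_)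
open import Data.List.Relation.Binary.Subset.Propositional.Properties
  using (xs⊆xs++ys; xs⊆ys++xs)
open import Data.List.Relation.Unary.All as All using (All; []; _∷_)
open import Data.List.Relation.Unary.All.Properties as All using ()
open import Data.List.Relation.Unary.AllPairs using (AllPairs; []; _∷_)
open import Data.List.Relation.Unary.Any as Any using (Any; here; there)
open import Data.List.Relation.Unary.Any.Properties as Any using ()
open import Data.Nat.Base using (ℕ; zero; suc)
open import Data.Product.Base using (Σ; Σ-syntax; ∃; ∃-syntax; _×_; _,_; proj₁; proj₂)
open import Data.Sum.Base using (_⊎_; inj₁; inj₂; [_,_]′)
open import Data.Unit.Polymorphic.Base using (⊤)
open import Data.Vec.Functional as Vector using (Vector)
open import Function.Base using (_∘_; id)
open import Function.Bundles using (Func; Equivalence; _⇔_; mk⇔)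
open import Relation.Binary.Bundles using (Setoid)
open import Relation.Binary.Lattice.Structures using (IsDistributiveLattice)
open import Relation.Binary.PropositionalEquality.Core using (_≡_; refl)
open import Relation.Binary.Structures using (IsEquivalence)
open import Relation.Nullary.Decidable.Core using (yes; no; True; toWitness; fromWitness)
open import Relation.Nullary.Negation.Core using (¬_)
open import Relation.Unary using (Pred; _∈_; _⊆_; _∪_; _∩_; ∁)

private
  variable
    ℓ κ : Level
    𝓛 : Signature ℓ

-- Subalgebras, images and epimorphisms.

SubalgebraClosed : {𝓛 : Signature ℓ} → Class 𝓛 κ → Set (lsuc ℓ ⊔ κ)
SubalgebraClosed {𝓛 = 𝓛} 𝒦 =
  ∀ {B : Algebra 𝓛} (A : Subalgebra B) → B ∈ 𝒦 → Subalgebra.algebra A ∈ 𝒦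

infixr 9 _∘ʰ_

_∘ʰ_ : {A B C : Algebra 𝓛} → Hom B C → Hom A B → Hom A C
_∘ʰ_ {C = C} g h = record
  { func     = record { to = g.to ∘ h.to ; cong = g.cong ∘ h.cong }
  ; preserve = λ f xs → C.trans (g.cong (h.preserve f xs)) (g.preserve f (h.to ∘ xs))
  }
  where
  module C = Algebra C
  module g = Hom g
  module h = Hom h

⟦⟧-hom : {A B : Algebra 𝓛} (h : Hom A B) {n : ℕ} (t : Term 𝓛 n) (ρ : Vector (Algebra.Carrier A) n) →
         Algebra._≈_ B (Hom.to h (⟦_⟧ A t ρ)) (⟦_⟧ B t (Hom.to h ∘ ρ))
⟦⟧-hom {B = B} h (var i)    ρ = Algebra.refl B
⟦⟧-hom {B = B} h (app f ts) ρ =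
  B.trans (Hom.preserve h f _) (B.op-cong f (λ i → ⟦⟧-hom h (ts i) ρ))
  where module B = Algebra B

inclusion : {B : Algebra 𝓛} (A : Subalgebra B) → Hom (Subalgebra.algebra A) B
inclusion {B = B} A = record
  { func     = record { to = proj₁ ; cong = id }
  ; preserve = λ f xs → Algebra.refl B
  }

image : {A B : Algebra 𝓛} → Hom A B → Subalgebra B
image {A = A} {B} h = record
  { member    = λ b → ∃[ a ] to a B.≈ b
  ; respects  = λ b≈b′ (a , ha≈b) → a , B.trans ha≈b b≈b′
  ; closed    = λ f ps → A.op f (proj₁ ∘ ps) ,
                         B.trans (preserve f _) (B.op-cong f (proj₂ ∘ ps))
  ; inhabited = to A.nonempty , A.nonempty , B.refl
  }
  where
  module A = Algebra A
  module B = Algebra B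
  open Hom h

module _ {𝓛 : Signature ℓ} {B : Algebra 𝓛} (A : Subalgebra B) where
  private
    module B = Algebra B
    A′ = Subalgebra.algebra A

  ⟦⟧-sub : ∀ {n} (t : Term 𝓛 n) ρ → proj₁ (⟦_⟧ A′ t ρ) B.≈ ⟦_⟧ B t (proj₁ ∘ ρ)
  ⟦⟧-sub = ⟦⟧-hom (inclusion A)

  -- Proved in both directions at once, since negation swaps them. Universal sentences therefore
  -- pass to subalgebras.
  Holds-sub : ∀ {n} (φ : QuantifierFree 𝓛 n) ρ → Holds A′ φ ρ ⇔ Holds B φ (proj₁ ∘ ρ)
  Holds-sub (s ≐ t) ρ = mk⇔
    (λ p → B.trans (B.sym (⟦⟧-sub s ρ)) (B.trans p (⟦⟧-sub t ρ)))
    (λ p → B.trans (⟦⟧-sub s ρ) (B.trans p (B.sym (⟦⟧-sub t ρ))))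
  Holds-sub (not φ) ρ = mk⇔ (_∘ φ.from) (_∘ φ.to)
    where module φ = Equivalence (Holds-sub φ ρ)
  Holds-sub (φ and ψ) ρ = mk⇔
    (λ (p , q) → φ.to p , ψ.to q) (λ (p , q) → φ.from p , ψ.from q)
    where
    module φ = Equivalence (Holds-sub φ ρ)
    module ψ = Equivalence (Holds-sub ψ ρ)
  Holds-sub (φ or ψ) ρ = mk⇔
    [ inj₁ ∘ φ.to , inj₂ ∘ ψ.to ]′ [ inj₁ ∘ φ.from , inj₂ ∘ ψ.from ]′
    where
    module φ = Equivalence (Holds-sub φ ρ)
    module ψ = Equivalence (Holds-sub ψ ρ)

variety-sub : {𝒱 : Class 𝓛 κ} → IsVariety 𝒱 → SubalgebraClosed 𝒱
variety-sub (E , axiomatizes) {B} A B∈𝒱 = Equivalence.from (axiomatizes _) λ e e∈E ρ →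
  Equivalence.from (Holds-sub A (Identity.lhs e ≐ Identity.rhs e) ρ)
    (Equivalence.to (axiomatizes B) B∈𝒱 e e∈E _)

universal-sub : {𝒦 : Class 𝓛 κ} → IsUniversalClass 𝒦 → SubalgebraClosed 𝒦
universal-sub (Φ , axiomatizes) {B} A B∈𝒦 = Equivalence.from (axiomatizes _) λ σ σ∈Φ ρ →
  Equivalence.from (Holds-sub A (UniversalSentence.matrix σ) ρ)
    (Equivalence.to (axiomatizes B) B∈𝒦 σ σ∈Φ _)

-- The inclusion of an epic subalgebra is an epimorphism. Conversely, the image of an epimorphism is
-- an epic subalgebra, and closure under subalgebras puts it in `𝒦`.
surjectiveEpis⇔epicSubalgebrasTotal : {𝒦 : Class 𝓛 κ} → SubalgebraClosed 𝒦 →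
  HasSurjectiveEpis 𝒦 ⇔ EpicSubalgebrasTotal 𝒦
surjectiveEpis⇔epicSubalgebrasTotal {𝒦 = 𝒦} sub = mk⇔ total surjective
  where
  total : HasSurjectiveEpis 𝒦 → EpicSubalgebrasTotal 𝒦
  total es B A A∈𝒦 B∈𝒦 epic b with es _ B A∈𝒦 B∈𝒦 (inclusion A)
    (λ C C∈𝒦 g g′ eq → epic C C∈𝒦 g g′ λ a a∈A → eq (a , a∈A)) b
  ... | (a , a∈A) , hits = Subalgebra.respects A (hits {a , a∈A} (Algebra.refl B)) a∈A

  surjective : EpicSubalgebrasTotal 𝒦 → HasSurjectiveEpis 𝒦
  surjective total A B A∈𝒦 B∈𝒦 h epi b
    with total B (image h) (sub (image h) B∈𝒦) B∈𝒦
      (λ C C∈𝒦 g g′ eq → epi C C∈𝒦 g g′ λ a → eq (Hom.to h a) (a , Algebra.refl B)) b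
  ... | a , ha≈b = a , λ z≈a → Algebra.trans B (Hom.cong h z≈a) ha≈b

-- Quotients and inverse images of congruences.

infixl 7 _/_

-- Only the equality is coarsened: each element represents its own class, and `projection` is the
-- identity on elements.
_/_ : (A : Algebra 𝓛) → Congruence A → Algebra 𝓛
A / θ = record
  { setoid   = record { isEquivalence = isEquivalence }
  ; op       = Algebra.op A
  ; op-cong  = compatible
  ; nonempty = Algebra.nonempty A
  }
  where open Congruence θ

module _ {𝓛 : Signature ℓ} {A : Algebra 𝓛} where
  private
    module A = Algebra A

  ⟦⟧-quotient : ∀ θ {n} (t : Term 𝓛 n) ρ → ⟦_⟧ (A / θ) t ρ A.≈ ⟦_⟧ A t ρ
  ⟦⟧-quotient θ (var i)    ρ = A.refl
  ⟦⟧-quotient θ (app f ts) ρ = A.op-cong f (λ i → ⟦⟧-quotient θ (ts i) ρ)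

  projection : ∀ θ → Hom A (A / θ)
  projection θ = record
    { func     = record { to = id ; cong = Congruence.reflexive θ }
    ; preserve = λ f xs → Algebra.refl (A / θ)
    }

  comap : {B : Algebra 𝓛} → Hom A B → Congruence B → Congruence A
  comap {B} h θ = record
    { rel           = λ x y → rel (to x) (to y)
    ; isEquivalence = record { refl = θ.refl ; sym = θ.sym ; trans = θ.trans }
    ; reflexive     = reflexive ∘ cong
    ; compatible    = λ f ps → θ.trans (reflexive (preserve f _))
        (θ.trans (compatible f ps) (reflexive (Algebra.sym B (preserve f _))))
    }
    where
    open Hom h
    open Congruence θ
    module θ = IsEquivalence isEquivalence

variety-quotient : {𝒱 : Class 𝓛 κ} → IsVariety 𝒱 → {A : Algebra 𝓛} → A ∈ 𝒱 →
                   ∀ θ → A / θ ∈ 𝒱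
variety-quotient (E , axiomatizes) {A} A∈𝒱 θ =
  Equivalence.from (axiomatizes _) λ e e∈E ρ →
    let open Identity e in Congruence.reflexive θ
      (A.trans (⟦⟧-quotient θ lhs ρ)
        (A.trans (Equivalence.to (axiomatizes A) A∈𝒱 e e∈E ρ)
          (A.sym (⟦⟧-quotient θ rhs ρ))))
  where module A = Algebra A

module Classical (em : ∀ {a} → ExcludedMiddle a)
                 (ac : ∀ {a ℓ₁ b ℓ₂} → AxiomOfChoice a ℓ₁ b ℓ₂) where

  -- Consequences of excluded middle.

  byContradiction : ∀ {p} {P : Set p} → ¬ ¬ P → P
  byContradiction {P = P} ¬¬p with em {P = P}
  ... | yes p = p
  ... | no ¬p = ⊥-elim (¬¬p ¬p)

  ¬∀⇒∃¬ : ∀ {a p} {A : Set a} {P : Pred A p} → ¬ (∀ x → P x) → ∃[ x ] ¬ P x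
  ¬∀⇒∃¬ ¬∀ = byContradiction λ ¬∃ → ¬∀ λ x → byContradiction λ ¬Px → ¬∃ (x , ¬Px)

  -- Propositional resizing: excluded middle makes every proposition
  -- equivalent to one in any given universe.
  record Resize {p} (m : Level) (P : Set p) : Set m where
    constructor resized
    field decided : Lift m (True (em {P = P}))

  resize : ∀ {p m} {P : Set p} → P → Resize m P
  resize p = resized (lift (fromWitness p))

  unresize : ∀ {p m} {P : Set p} → Resize m P → P
  unresize (resized (lift t)) = toWitness t

  -- Baker-Pixley merging of local approximations.

  module _ {s a u} {S : Set s} {A : Set a} (U : A → Pred S u)
           (majority : A → A → A → A)
           (maj-₁₂ : ∀ {x y z s} → U x s → U y s → U (majority x y z) s)
           (maj-₁₃ : ∀ {x y z s} → U x s → U z s → U (majority x y z) s)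
           (maj-₂₃ : ∀ {x y z s} → U y s → U z s → U (majority x y z) s)
           where

    -- Read `U x` as the set of points where `x` is correct; a covered set has one element correct
    -- throughout it.
    Covered : ∀ {p} → Pred S p → Set (s ⊔ a ⊔ u ⊔ p)
    Covered Y = ∃[ x ] Y ⊆ U x

    -- Each of `X`, `Y`, `Z` occurs in two of the three unions, so two of the three witnesses are
    -- correct there and the majority follows them.
    covered-majority : ∀ {p} {X Y Z : Pred S p} →
      Covered (X ∪ Y) → Covered (X ∪ Z) → Covered (Y ∪ Z) → Covered ((X ∪ Y) ∪ Z)
    covered-majority (x , xy) (y , xz) (z , yz) = majority x y z , λ where
      (inj₁ (inj₁ p)) → maj-₁₂ (xy (inj₁ p)) (xz (inj₁ p))
      (inj₁ (inj₂ q)) → maj-₁₃ (xy (inj₂ q)) (yz (inj₁ q))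
      (inj₂ r)        → maj-₂₃ (xz (inj₂ r)) (yz (inj₂ r))

    -- `Y` accumulates the sets treated so far. After absorbing `Z`, `covered-majority` restores the
    -- pairwise hypothesis for `Y ∪ Z` against each remaining set.
    covered-⋃ : ∀ {p} (Y : Pred S p) (Ys : List (Pred S p)) → Covered Y →
      All (λ Z → Covered (Y ∪ Z)) Ys → AllPairs (λ Z W → Covered (Z ∪ W)) Ys →
      ∃[ x ] ∀ s → s ∈ Y ⊎ Any (s ∈_) Ys → s ∈ U x
    covered-⋃ Y [] (x , Y⊆) [] [] = x , λ { s (inj₁ p) → Y⊆ p }
    covered-⋃ Y (Z ∷ Ys) Y-cov (YZ ∷ YW) (ZW ∷ WW)
      with covered-⋃ (Y ∪ Z) Ys YZ (All.zipWith (λ (p , q) → covered-majority YZ p q) (YW , ZW)) WW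
    ... | x , covers = x , λ where
      s (inj₁ p)         → covers s (inj₁ (inj₁ p))
      s (inj₂ (here q))  → covers s (inj₁ (inj₂ q))
      s (inj₂ (there r)) → covers s (inj₂ r)

    Homogeneous : ∀ {p} → List A → Pred S p → Set (s ⊔ a ⊔ u ⊔ p)
    Homogeneous xs Y = ∀ {s t} → s ∈ Y → t ∈ Y → ∀ {x} → x ∈ˡ xs → s ∈ U x → t ∈ U x

    -- The atoms of the Boolean algebra generated by the sets U x, x ∈ xs.
    cells : List A → List (Pred S u)
    cells []       = (λ _ → ⊤) ∷ []
    cells (x ∷ xs) = map (_∩ U x) (cells xs) ++ map (_∩ ∁ (U x)) (cells xs)

    cells-homogeneous : ∀ xs → All (Homogeneous xs) (cells xs)
    cells-homogeneous []       = (λ _ _ ()) ∷ []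
    cells-homogeneous (x ∷ xs) = All.++⁺
      (All.map⁺ (All.map (λ where
        hom (_ , _) (_ , q) (here refl) _ → q
        hom (p , _) (q , _) (there y∈)    → hom p q y∈) (cells-homogeneous xs)))
      (All.map⁺ (All.map (λ where
        hom (_ , ¬p) (_ , _) (here refl) p → ⊥-elim (¬p p)
        hom (p , _)  (q , _) (there y∈)    → hom p q y∈) (cells-homogeneous xs)))

    cells-cover : ∀ xs s → Any (s ∈_) (cells xs)
    cells-cover []       s = here _
    cells-cover (x ∷ xs) s with em {P = U x s}
    ... | yes p = Any.++⁺ˡ (Any.map⁺ (Any.map (_, p) (cells-cover xs s)))
    ... | no ¬p = Any.++⁺ʳ _ (Any.map⁺ (Any.map (_, ¬p) (cells-cover xs s)))

    module _ (x₀ : A) (xs : List A) (pairwise : ∀ s t → ∃[ x ] x ∈ˡ xs × s ∈ U x × t ∈ U x) where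

      -- One point of each set suffices: an element of `xs` correct at both is, by homogeneity,
      -- correct on both sets. Empty sets impose no condition.
      covered-pair : ∀ {p} {Y Z : Pred S p} → Homogeneous xs Y → Homogeneous xs Z → Covered (Y ∪ Z)
      covered-pair {Y = Y} {Z} homY homZ with em {P = ∃ Y} | em {P = ∃ Z}
      ... | yes (s , s∈Y) | yes (t , t∈Z) = let x , x∈ , Us , Ut = pairwise s t in
        x , [ (λ q → homY s∈Y q x∈ Us) , (λ q → homZ t∈Z q x∈ Ut) ]′
      ... | yes (s , s∈Y) | no ¬Z = let x , x∈ , Us , _ = pairwise s s in
        x , [ (λ q → homY s∈Y q x∈ Us) , (λ q → ⊥-elim (¬Z (_ , q))) ]′
      ... | no ¬Y | yes (t , t∈Z) = let x , x∈ , Ut , _ = pairwise t t in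
        x , [ (λ q → ⊥-elim (¬Y (_ , q))) , (λ q → homZ t∈Z q x∈ Ut) ]′
      ... | no ¬Y | no ¬Z = x₀ , [ (λ q → ⊥-elim (¬Y (_ , q))) , (λ q → ⊥-elim (¬Z (_ , q))) ]′

      covered-pairs : ∀ {p} {Ys : List (Pred S p)} → All (Homogeneous xs) Ys →
                      AllPairs (λ Y Z → Covered (Y ∪ Z)) Ys
      covered-pairs []           = []
      covered-pairs (hom ∷ homs) = All.map (covered-pair hom) homs ∷ covered-pairs homs

      bakerPixley : ∃[ x ] ∀ s → s ∈ U x
      -- The accumulator starts as the empty set, which `x₀` covers vacuously.
      bakerPixley with covered-⋃ (λ _ → ⊥) (cells xs) (x₀ , λ ())
        (All.map (covered-pair λ ()) (cells-homogeneous xs))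
        (covered-pairs (cells-homogeneous xs))
      ... | x , covers = x , λ s → covers s (inj₂ (cells-cover xs s))

  -- Zorn's lemma.

  module Zorn {x m p} {X : Set x} (P : Pred (Pred X m) p) where

    ⋃ : ∀ {c} → Pred (Pred X m) c → Pred X m
    ⋃ C x = Resize m (∃[ S ] C S × S x)

    IsChain : ∀ {c} → Pred (Pred X m) c → Set _
    IsChain C = ∀ {S T} → C S → C T → S ⊆ T ⊎ T ⊆ S

    ⋃-upper : ∀ {c} {C : Pred (Pred X m) c} {S} → C S → S ⊆ ⋃ C
    ⋃-upper S∈C x∈S = resize (_ , S∈C , x∈S)

    ⋃-least : ∀ {c t} {C : Pred (Pred X m) c} {T : Pred X t} → (∀ {S} → C S → S ⊆ T) → ⋃ C ⊆ T
    ⋃-least C≤T x∈⋃ with unresize x∈⋃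
    ... | _ , S∈C , x∈S = C≤T S∈C x∈S

    IsMaximal : Pred (Pred X m) _
    IsMaximal M = ∀ S → P S → M ⊆ S → S ⊆ M

    -- The Bourbaki–Witt tower over S₀ of an inflationary operator next, which
    -- turns out to be a chain; its union is then a fixed point of next.
    module Tower (next : Pred X m → Pred X m)
                 (next-cong : ∀ {S T} → S ⊆ T → T ⊆ S → next S ⊆ next T)
                 (inflationary : ∀ {S} → S ⊆ next S)
                 (S₀ : Pred X m) where

      data InTower : Pred (Pred X m) (x ⊔ lsuc m) where
        start : InTower S₀
        step  : ∀ {S} → InTower S → InTower (next S)
        -- The family must be nonempty, as an empty union need not contain `S₀`.
        union : (C : Pred (Pred X m) m) → (∀ {S} → C S → InTower S) → ∃ C → InTower (⋃ C)

      start-least : ∀ {S} → InTower S → S₀ ⊆ S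
      start-least start                     = id
      start-least (step S∈)                 = inflationary ∘ start-least S∈
      start-least (union C C⊆ (T , T∈C)) x∈ = ⋃-upper T∈C (start-least (C⊆ T∈C) x∈)

      IsExtreme : Pred (Pred X m) _
      IsExtreme E = ∀ {S} → InTower S → S ⊆ E → ¬ (E ⊆ S) → next S ⊆ E

      -- Induction on `S`. At a step with `S ⊆ E`, either `S` equals `E` and `next-cong` applies, or
      -- extremity of `E` does. At a union, some member lies above `next E` or all lie below `E`.
      extreme-dichotomy : ∀ {E} → InTower E → IsExtreme E →
                          ∀ {S} → InTower S → S ⊆ E ⊎ next E ⊆ S
      extreme-dichotomy E∈ extreme start = inj₁ (start-least E∈)
      extreme-dichotomy {E} E∈ extreme (step {S} S∈) with extreme-dichotomy E∈ extreme S∈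
      ... | inj₂ E′⊆S = inj₂ (inflationary ∘ E′⊆S)
      ... | inj₁ S⊆E with em {P = E ⊆ S}
      ...   | yes E⊆S = inj₂ (next-cong E⊆S S⊆E)
      ...   | no E⊈S  = inj₁ (extreme S∈ S⊆E E⊈S)
      extreme-dichotomy {E} E∈ extreme (union C C⊆ _) with em {P = ∃[ S ] C S × next E ⊆ S}
      ... | yes (S , S∈C , E′⊆S) = inj₂ (⋃-upper S∈C ∘ E′⊆S)
      ... | no none = inj₁ (⋃-least below)
        where
        below : ∀ {S} → C S → S ⊆ E
        below S∈C with extreme-dichotomy E∈ extreme (C⊆ S∈C)
        ... | inj₁ S⊆E  = S⊆E
        ... | inj₂ E′⊆S = ⊥-elim (none (_ , S∈C , E′⊆S))

      -- Induction on `E`, applying the dichotomy to its predecessor or, for a union, to a member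
      -- not contained in `S`.
      all-extreme : ∀ {E} → InTower E → IsExtreme E
      all-extreme start S∈ _ S₀⊈S = ⊥-elim (S₀⊈S (start-least S∈))
      all-extreme (step {E} E∈) {S} S∈ S⊆E′ E′⊈S
        with extreme-dichotomy E∈ (all-extreme E∈) S∈
      ... | inj₂ E′⊆S = ⊥-elim (E′⊈S E′⊆S)
      ... | inj₁ S⊆E with em {P = E ⊆ S}
      ...   | yes E⊆S = next-cong S⊆E E⊆S
      ...   | no E⊈S  = inflationary ∘ all-extreme E∈ S∈ S⊆E E⊈S
      all-extreme (union C C⊆ _) {S} S∈ _ ⋃⊈S with em {P = ∃[ E ] C E × ¬ (E ⊆ S)}
      ... | no none = ⊥-elim (⋃⊈S (⋃-least λ E∈C → byContradiction λ E⊈S → none (_ , E∈C , E⊈S)))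
      ... | yes (E , E∈C , E⊈S) with extreme-dichotomy (C⊆ E∈C) (all-extreme (C⊆ E∈C)) S∈
      ...   | inj₁ S⊆E  = ⋃-upper E∈C ∘ all-extreme (C⊆ E∈C) S∈ S⊆E E⊈S
      ...   | inj₂ E′⊆S = ⊥-elim (E⊈S (E′⊆S ∘ inflationary))

      tower-chain : IsChain InTower
      tower-chain S∈ T∈ with extreme-dichotomy T∈ (all-extreme T∈) S∈
      ... | inj₁ S⊆T  = inj₁ S⊆T
      ... | inj₂ T′⊆S = inj₂ (T′⊆S ∘ inflationary)

      top : Pred X m
      -- Resizing brings the whole tower down to the level that `union` accepts, so `top` is itself
      -- in the tower.
      top = ⋃ {m} (Resize m ∘ InTower)

      top∈tower : InTower top
      top∈tower = union _ unresize (S₀ , resize start)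

      top-fixed : next top ⊆ top
      top-fixed = ⋃-upper (resize (step top∈tower))

    module _ (P-resp : ∀ {S T} → S ⊆ T → T ⊆ S → P S → P T)
             (P-chain : ∀ (C : Pred (Pred X m) m) → (∀ {S} → C S → P S) → IsChain C → ∃ C → P (⋃ C))
             where

      record Step (S T : Pred X m) : Set (x ⊔ lsuc m ⊔ p) where
        field
          extends   : S ⊆ T
          preserves : P S → P T
          fixed⇒max : T ⊆ S → IsMaximal S

      open Step

      step-exists : ∀ S → ∃ (Step S)
      step-exists S with em {P = ∃[ T ] P T × S ⊆ T × ¬ (T ⊆ S)}
      ... | yes (T , PT , S⊆T , T⊈S) = T , record
        { extends = S⊆T ; preserves = λ _ → PT ; fixed⇒max = λ T⊆S → ⊥-elim (T⊈S T⊆S) }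
      ... | no none = S , record
        { extends = id ; preserves = id
        ; fixed⇒max = λ _ T PT S⊆T → byContradiction λ T⊈S → none (T , PT , S⊆T , T⊈S) }

      -- Choice for setoids is needed so that next respects equality of subsets.
      predicates steps : Setoid _ _
      predicates = record
        { Carrier = Pred X m
        ; _≈_ = λ S T → S ⊆ T × T ⊆ S
        ; isEquivalence = record
          { refl = id , id ; sym = λ (p , q) → q , p
          ; trans = λ (p , q) (p′ , q′) → p′ ∘ p , q ∘ q′ }
        }
      steps = record
        { Carrier = Σ (Pred X m × Pred X m) λ (S , T) → Step S T
        ; _≈_ = λ ((S , T) , _) ((S′ , T′) , _) → (S ⊆ S′ × S′ ⊆ S) × (T ⊆ T′ × T′ ⊆ T)
        ; isEquivalence = record
          { refl = (id , id) , (id , id)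
          ; sym = λ ((p , q) , (r , s)) → (q , p) , (s , r)
          ; trans = λ ((p , q) , (r , s)) ((p′ , q′) , (r′ , s′)) →
              (p′ ∘ p , q ∘ q′) , (r′ ∘ r , s ∘ s′) }
        }

      source : Func steps predicates
      source = record { to = proj₁ ∘ proj₁ ; cong = proj₁ }

      section : Σ[ g ∈ Func predicates steps ] ∀ S →
                Setoid._≈_ predicates (proj₁ (proj₁ (Func.to g S))) S
      section = ac steps predicates source λ S →
        let T , st = step-exists S in ((S , T) , st) , proj₁

      next : Pred X m → Pred X m
      next S = proj₂ (proj₁ (Func.to (proj₁ section) S))

      next-step : ∀ S → Step S (next S)
      next-step S = record
        { extends   = extends st ∘ proj₂ eq
        ; preserves = λ PS → preserves st (P-resp (proj₂ eq) (proj₁ eq) PS)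
        ; fixed⇒max = λ T⊆S U PU S⊆U u →
            proj₁ eq (fixed⇒max st (proj₂ eq ∘ T⊆S) U PU (S⊆U ∘ proj₁ eq) u)
        }
        where
        st = proj₂ (Func.to (proj₁ section) S)
        -- The step chosen starts at a set equal to `S` only up to mutual inclusion, so its
        -- properties are transported along `eq`.
        eq = proj₂ section S

      zorn : ∀ S₀ → P S₀ → ∃[ M ] P M × S₀ ⊆ M × IsMaximal M
      zorn S₀ PS₀ = top , tower⊆P top∈tower , start-least top∈tower ,
                    fixed⇒max (next-step top) top-fixed
        where
        open Tower next
          (λ S⊆T T⊆S → proj₁ (proj₂ (Func.cong (proj₁ section) (S⊆T , T⊆S))))
          (λ {S} → extends (next-step S)) S₀

        tower⊆P : ∀ {S} → InTower S → P S
        tower⊆P start            = PS₀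
        tower⊆P (step {S} S∈)    = preserves (next-step S) (tower⊆P S∈)
        tower⊆P (union C C⊆ one) =
          P-chain C (tower⊆P ∘ C⊆) (λ S∈C T∈C → tower-chain (C⊆ S∈C) (C⊆ T∈C)) one

  -- Filters and ultrafilters.

  record IsFilter {i m} {I : Set i} (F : Pred (Pred I m) m) : Set (i ⊔ lsuc m) where
    field
      whole  : ∀ {p} → (∀ i → i ∈ p) → F p
      upward : ∀ {p q} → p ⊆ q → F p → F q
      meet   : ∀ {p q} → F p → F q → F (p ∩ q)
      proper : ∀ {p} → F p → ∃ p

    meet-Fin : ∀ n {p : Fin n → Pred I m} → (∀ k → F (p k)) → F (λ i → ∀ k → i ∈ p k)
    meet-Fin zero    ps = whole λ i ()
    meet-Fin (suc n) ps = upward (λ (q , qs) → ∀-cons q qs) (meet (ps zero) (meet-Fin n (ps ∘ suc)))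

  IsUltra : ∀ {i m} {I : Set i} → Pred (Pred I m) m → Set (i ⊔ lsuc m)
  IsUltra F = ∀ p → F p ⊎ F (∁ p)

  module _ {i m : Level} {I : Set i} where
    open Zorn {m = m} (IsFilter {m = m} {I = I})
    open IsFilter

    -- If `∁ p` is not in `M`, then `M` and `p` generate a proper filter `M′`, and maximality puts
    -- `p` into `M`.
    maximal⇒ultra : ∀ {M} → IsFilter M → IsMaximal M → IsUltra M
    maximal⇒ultra {M} filter maximal p with em {P = M (∁ p)}
    ... | yes M∁p = inj₂ M∁p
    ... | no ¬M∁p = inj₁ (maximal M′ filter′
                      (λ Mq → resize (_ , Mq , proj₁))
                      (resize (_ , whole filter {λ _ → ⊤} _ , proj₂)))
      where
      M′ : Pred (Pred I m) m
      M′ q = Resize m (∃[ r ] M r × r ∩ p ⊆ q)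

      filter′ : IsFilter M′
      filter′ .whole all = resize (_ , whole filter {λ _ → ⊤} _ , λ _ → all _)
      filter′ .upward q⊆q′ M′q with unresize M′q
      ... | r , Mr , r∩p⊆q = resize (r , Mr , λ x → q⊆q′ (r∩p⊆q x))
      filter′ .meet M′q M′q′ with unresize M′q | unresize M′q′
      ... | r , Mr , r∩p⊆q | r′ , Mr′ , r′∩p⊆q′ =
        resize (r ∩ r′ , meet filter Mr Mr′ ,
                λ ((x , x′) , y) → r∩p⊆q (x , y) , r′∩p⊆q′ (x′ , y))
      filter′ .proper M′q with unresize M′q
      ... | r , Mr , r∩p⊆q = byContradiction λ empty →
        ¬M∁p (upward filter (λ x∈r x∈p → empty (_ , r∩p⊆q (x∈r , x∈p))) Mr)

    ultrafilter : ∀ F → IsFilter F → ∃[ M ] IsFilter M × F ⊆ M × IsUltra M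
    ultrafilter F filter with zorn resp chain F filter
      where
      resp : ∀ {F G} → F ⊆ G → G ⊆ F → IsFilter F → IsFilter G
      resp F⊆G G⊆F filter = record
        { whole  = λ all → F⊆G (whole filter all)
        ; upward = λ p⊆q Gp → F⊆G (upward filter p⊆q (G⊆F Gp))
        ; meet   = λ Gp Gq → F⊆G (meet filter (G⊆F Gp) (G⊆F Gq))
        ; proper = λ Gp → proper filter (G⊆F Gp)
        }

      chain : ∀ (C : Pred (Pred (Pred I m) m) m) → (∀ {F} → C F → IsFilter F) →
              IsChain C → ∃ C → IsFilter (⋃ C)
      chain C filters isChain (F , F∈C) .whole all = ⋃-upper F∈C (whole (filters F∈C) all)
      chain C filters isChain _ .upward p⊆q p∈ with unresize p∈
      ... | G , G∈C , Gp = ⋃-upper G∈C (upward (filters G∈C) p⊆q Gp)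
      chain C filters isChain _ .meet p∈ q∈ with unresize p∈ | unresize q∈
      ... | G , G∈C , Gp | H , H∈C , Hq with isChain G∈C H∈C
      ...   | inj₁ G⊆H = ⋃-upper H∈C (meet (filters H∈C) (G⊆H Gp) Hq)
      ...   | inj₂ H⊆G = ⋃-upper G∈C (meet (filters G∈C) Gp (H⊆G Hq))
      chain C filters isChain _ .proper p∈ with unresize p∈
      ... | G , G∈C , Gp = proper (filters G∈C) Gp
    ... | M , filterM , F⊆M , maximal = M , filterM , F⊆M , maximal⇒ultra filterM maximal

  -- Lists stand for finite subsets. Every filter extending this one contains, for each `a`, the set
  -- of lists in which `a` occurs.
  tails : {A : Set ℓ} → Pred (Pred (List A) ℓ) ℓ
  tails p = ∃[ xs ] ∀ {ys} → xs ⊆ˡ ys → ys ∈ p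

  tails-isFilter : {A : Set ℓ} → IsFilter (tails {A = A})
  tails-isFilter = record
    { whole  = λ all → [] , λ _ → all _
    ; upward = λ p⊆q (xs , tail) → xs , λ xs⊆ → p⊆q (tail xs⊆)
    ; meet   = λ (xs , p-tail) (ys , q-tail) → xs ++ ys ,
        λ ⊆zs → p-tail (⊆zs ∘ xs⊆xs++ys xs ys) , q-tail (⊆zs ∘ xs⊆ys++xs ys xs)
    ; proper = λ (xs , tail) → xs , tail id
    }

  -- Ultraproducts and Łoś's theorem.

  -- The quotient by the limit congruence is the image of A in the ultraproduct
  -- of the quotients A / θ i; Łoś's theorem holds for quantifier-free formulas.
  module Limit {𝓛 : Signature ℓ} {A : Algebra 𝓛} {I : Set ℓ} (θ : I → Congruence A)
               {U : Pred (Pred I ℓ) ℓ} (filter : IsFilter U) where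
    open IsFilter filter
    private
      module A = Algebra A
      module θ i = Congruence (θ i)
      module ≈θ i = IsEquivalence (Congruence.isEquivalence (θ i))

    limit : Congruence A
    limit = record
      { rel           = λ x y → U (λ i → θ.rel i x y)
      ; isEquivalence = record
        { refl  = whole λ i → ≈θ.refl i
        ; sym   = upward λ {i} → ≈θ.sym i
        ; trans = λ p q → upward (λ {i} (p , q) → ≈θ.trans i p q) (meet p q)
        }
      ; reflexive     = λ p → whole λ i → θ.reflexive i p
      ; compatible    = λ f ps → upward (λ {i} → θ.compatible i f) (meet-Fin _ ps)
      }

    module _ (ultra : IsUltra U) where

      Łoś : ∀ {n} (φ : QuantifierFree 𝓛 n) ρ →
            Holds (A / limit) φ ρ ⇔ U (λ i → Holds (A / θ i) φ ρ)
      Łoś (s ≐ t) ρ = mk⇔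
        (upward λ {i} p → ≈θ.trans i (shift i s)
          (≈θ.trans i p (≈θ.sym i (shift i t))))
        (upward λ {i} p → ≈θ.trans i (≈θ.sym i (shift i s))
          (≈θ.trans i p (shift i t)))
        where
        shift : ∀ i t → θ.rel i (⟦_⟧ (A / θ i) t ρ) (⟦_⟧ (A / limit) t ρ)
        shift i t = θ.reflexive i
          (A.trans (⟦⟧-quotient (θ i) t ρ) (A.sym (⟦⟧-quotient limit t ρ)))
      Łoś (not φ) ρ = mk⇔
        (λ ¬φ → [ ⊥-elim ∘ ¬φ ∘ φ.from , id ]′ (ultra _))
        (λ U¬φ φ → let i , ¬φᵢ , φᵢ = proper (meet U¬φ (φ.to φ)) in ¬φᵢ φᵢ)
        where module φ = Equivalence (Łoś φ ρ)
      Łoś (φ and ψ) ρ = mk⇔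
        (λ (p , q) → meet (φ.to p) (ψ.to q))
        (λ pq → φ.from (upward proj₁ pq) , ψ.from (upward proj₂ pq))
        where
        module φ = Equivalence (Łoś φ ρ)
        module ψ = Equivalence (Łoś ψ ρ)
      Łoś (φ or ψ) ρ = mk⇔
        [ upward inj₁ ∘ φ.to , upward inj₂ ∘ ψ.to ]′
        -- The ultrafilter decides the set where `φ` holds; if its complement is large, `ψ` holds on
        -- the large intersection with the disjunction.
        (λ pq → [ inj₁ ∘ φ.from ,
                  (λ ¬p → inj₂ (ψ.from (upward (λ (¬p , pq) → [ ⊥-elim ∘ ¬p , id ]′ pq)
                                               (meet ¬p pq)))) ]′ (ultra _))
        where
        module φ = Equivalence (Łoś φ ρ)
        module ψ = Equivalence (Łoś ψ ρ)

      universal-limit : {𝒦 : Class 𝓛 κ} → IsUniversalClass 𝒦 →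
                        (∀ i → A / θ i ∈ 𝒦) → A / limit ∈ 𝒦
      universal-limit (Φ , axiomatizes) A/θ∈𝒦 = Equivalence.from (axiomatizes _) λ σ σ∈Φ ρ →
        Equivalence.from (Łoś (UniversalSentence.matrix σ) ρ)
          (whole λ i → Equivalence.to (axiomatizes _) (A/θ∈𝒦 i) σ σ∈Φ ρ)

  -- Separating points by finitely subdirectly irreducible quotients.

  module Separation {𝓛 : Signature ℓ} (A : Algebra 𝓛) {u v : Algebra.Carrier A} where
    private
      module A = Algebra A
    open Congruence

    -- Subsets of A × A that are congruences omitting (u , v).
    record Omits (R : Pred (A.Carrier × A.Carrier) ℓ) : Set (lsuc ℓ) where
      field
        congruence : Congruence A
        sound      : ∀ {x y} → rel congruence x y → R (x , y)
        complete   : ∀ {x y} → R (x , y) → rel congruence x y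
        omits      : ¬ R (u , v)

    open Omits
    open Zorn Omits

    omits-resp : ∀ {R S} → R ⊆ S → S ⊆ R → Omits R → Omits S
    omits-resp R⊆S S⊆R om = record
      { congruence = congruence om
      ; sound      = λ p → R⊆S (sound om p)
      ; complete   = λ p → complete om (S⊆R p)
      ; omits      = λ p → omits om (S⊆R p)
      }

    omits-chain : ∀ (C : Pred (Pred (A.Carrier × A.Carrier) ℓ) ℓ) → (∀ {R} → C R → Omits R) →
                  IsChain C → ∃ C → Omits (⋃ C)
    omits-chain C om isChain (R₀ , R₀∈C) = record
      { congruence = record
        { rel           = λ x y → ⋃ C (x , y)
        ; isEquivalence = record
          { refl  = ⋃-upper R₀∈C (sound (om R₀∈C) (≈.refl R₀∈C))
          ; sym   = λ p → let R , R∈C , Rp = unresize p in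
              ⋃-upper R∈C (sound (om R∈C) (≈.sym R∈C (complete (om R∈C) Rp)))
          ; trans = λ {x} {y} {z} p q →
              let R , R∈C , f = bound 2 {(x , y) Vector.∷ (y , z) Vector.∷ Vector.[]}
                                      (∀-cons p (∀-cons q λ ())) in
              ⋃-upper R∈C (sound (om R∈C)
                (≈.trans R∈C (complete (om R∈C) (f 0F)) (complete (om R∈C) (f 1F))))
          }
        ; reflexive     = λ p → ⋃-upper R₀∈C (sound (om R₀∈C) (reflexive (congruence (om R₀∈C)) p))
        ; compatible    = λ f ps → let R , R∈C , Rps = bound _ ps in
            ⋃-upper R∈C (sound (om R∈C)
              (compatible (congruence (om R∈C)) f (λ k → complete (om R∈C) (Rps k))))
        }
      ; sound    = id
      ; complete = id
      ; omits    = λ p → let R , R∈C , Rp = unresize p in omits (om R∈C) Rp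
      }
      where
      module ≈ {R} (R∈C : C R) = IsEquivalence (isEquivalence (congruence (om R∈C)))

      -- Induction keeps the larger of two comparable members. As arities are finite, this makes the
      -- union compatible with the operations.
      bound : ∀ n {xs : Fin n → A.Carrier × A.Carrier} → (∀ k → ⋃ C (xs k)) →
              ∃[ R ] C R × (∀ k → R (xs k))
      bound zero    ps = R₀ , R₀∈C , λ ()
      bound (suc n) ps with unresize (ps zero) | bound n (ps ∘ suc)
      ... | R , R∈C , Rp | S , S∈C , Sps with isChain R∈C S∈C
      ...   | inj₁ R⊆S = S , S∈C , ∀-cons (R⊆S Rp) Sps
      ...   | inj₂ S⊆R = R , R∈C , ∀-cons Rp (λ k → S⊆R (Sps k))

    -- Every congruence strictly above a maximal one omitting (u , v) contains (u , v).
    fsi-separation : ¬ (u A.≈ v) → ∃[ θ ] FinitelySubdirectlyIrreducible (A / θ) × ¬ rel θ u v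
    fsi-separation u≉v with zorn omits-resp omits-chain (λ (x , y) → x A.≈ y) (record
      { congruence = Δ A ; sound = id ; complete = id ; omits = u≉v })
    ... | R , om , _ , maximal = θ , irreducible , λ p → omits om (sound om p)
      where
      θ = congruence om

      above : (α : Congruence (A / θ)) → ¬ (∀ {x y} → rel α x y → rel θ x y) → rel α u v
      above α α⊈θ = byContradiction λ ¬αuv → α⊈θ λ p → complete om
        (maximal (λ (x , y) → rel α x y)
          (record { congruence = comap (projection θ) α ; sound = id ; complete = id ; omits = ¬αuv })
          (λ q → reflexive α (complete om q)) p)

      irreducible : FinitelySubdirectlyIrreducible (A / θ)
      irreducible α β (_ , α∧β⊆θ) with em {P = ∀ {x y} → rel α x y → rel θ x y}
                                     | em {P = ∀ {x y} → rel β x y → rel θ x y}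
      ... | yes α⊆θ | _       = inj₁ (reflexive α , α⊆θ)
      ... | no _    | yes β⊆θ = inj₂ (reflexive β , β⊆θ)
      ... | no α⊈θ  | no β⊈θ  =
        ⊥-elim (omits om (sound om (α∧β⊆θ (above α α⊈θ , above β β⊈θ))))

  -- Free algebras of a variety.

  module FreeAlgebra {𝓛 : Signature ℓ} {𝒱 : Class 𝓛 κ} (isVariety : IsVariety 𝒱) (n : ℕ) where

    -- There are `suc n` generators, so that a variable witnesses nonemptiness. Resizing keeps the
    -- equality, which quantifies over all of `𝒱`, at level `ℓ`.
    Free : Algebra 𝓛
    Free = record
      { setoid = record
        { Carrier       = Term 𝓛 (suc n)
        ; _≈_           = λ s t → Resize ℓ (∀ A → A ∈ 𝒱 → ∀ ρ → Algebra._≈_ A (⟦_⟧ A s ρ) (⟦_⟧ A t ρ))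
        ; isEquivalence = record
          { refl  = resize λ A _ ρ → Algebra.refl A
          ; sym   = λ p → resize λ A A∈𝒱 ρ → Algebra.sym A (unresize p A A∈𝒱 ρ)
          ; trans = λ p q → resize λ A A∈𝒱 ρ →
              Algebra.trans A (unresize p A A∈𝒱 ρ) (unresize q A A∈𝒱 ρ)
          }
        }
      ; op       = app
      ; op-cong  = λ f ps → resize λ A A∈𝒱 ρ → Algebra.op-cong A f λ i → unresize (ps i) A A∈𝒱 ρ
      ; nonempty = var zero
      }

    eval : ∀ {A} → A ∈ 𝒱 → Vector (Algebra.Carrier A) (suc n) → Hom Free A
    eval {A} A∈𝒱 ρ = record
      { func     = record { to = λ t → ⟦_⟧ A t ρ ; cong = λ p → unresize p A A∈𝒱 ρ }
      ; preserve = λ f ts → Algebra.refl A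
      }

    free∈𝒱 : Free ∈ 𝒱
    free∈𝒱 = Equivalence.from (proj₂ isVariety Free) λ e e∈E σ → resize λ A A∈𝒱 ρ →
      let open Identity e
          module A = Algebra A
      in A.trans (⟦⟧-hom (eval A∈𝒱 ρ) lhs σ)
           (A.trans (Equivalence.to (proj₂ isVariety A) A∈𝒱 e e∈E _)
             (A.sym (⟦⟧-hom (eval A∈𝒱 ρ) rhs σ)))

    collapse : Fin (suc n) → Fin (suc n) → Congruence Free
    collapse i j = Cg Free λ s t → s ≡ var i × t ≡ var j

    -- The kernel of evaluation at `ρ` contains the pair generating the principal congruence
    -- `collapse i j`.
    collapse-eval : ∀ {A i j s t} → A ∈ 𝒱 → ∀ ρ → Algebra._≈_ A (ρ i) (ρ j) →
      Congruence.rel (collapse i j) s t → Algebra._≈_ A (⟦_⟧ A s ρ) (⟦_⟧ A t ρ)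
    collapse-eval {A} A∈𝒱 ρ ρi≈ρj =
      Cg-least Free (comap (eval A∈𝒱 ρ) (Δ A)) λ { (refl , refl) → ρi≈ρj }

  -- Majority terms and epic subalgebras of arithmetical varieties.

  module _ {𝓛 : Signature ℓ} {𝒱 : Class 𝓛 κ}
           (isVariety : IsVariety 𝒱) (arithmetical : IsArithmetical 𝒱) where

    -- The laws are conditional, so in a quotient they apply directly to arguments that are merely
    -- congruent.
    record MajorityTerm : Set (lsuc ℓ ⊔ κ) where
      field
        term   : Term 𝓛 3
        maj-₁₂ : ∀ {A} → A ∈ 𝒱 → ∀ ρ → let open Algebra A using (_≈_) in
                 ρ 0F ≈ ρ 1F → ρ 0F ≈ ⟦_⟧ A term ρ
        maj-₁₃ : ∀ {A} → A ∈ 𝒱 → ∀ ρ → let open Algebra A using (_≈_) in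
                 ρ 0F ≈ ρ 2F → ρ 0F ≈ ⟦_⟧ A term ρ
        maj-₂₃ : ∀ {A} → A ∈ 𝒱 → ∀ ρ → let open Algebra A using (_≈_) in
                 ρ 1F ≈ ρ 2F → ⟦_⟧ A term ρ ≈ ρ 2F

    -- In the free algebra on x, y, z the pair (x , z) lies in
    -- Cg(x,z) ∧ (Cg(x,y) ∨ Cg(y,z)), hence in
    -- (Cg(x,z) ∧ Cg(x,y)) ; (Cg(x,z) ∧ Cg(y,z)): the middle element is the term.
    majorityTerm : MajorityTerm
    majorityTerm = record
      { term   = proj₁ middle
      ; maj-₁₂ = λ A∈𝒱 ρ e → collapse-eval A∈𝒱 ρ e (proj₂ (proj₁ (proj₂ middle)))
      ; maj-₁₃ = λ A∈𝒱 ρ e → collapse-eval A∈𝒱 ρ e (proj₁ (proj₁ (proj₂ middle)))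
      ; maj-₂₃ = λ A∈𝒱 ρ e → collapse-eval A∈𝒱 ρ e (proj₂ (proj₂ (proj₂ middle)))
      }
      where
      open FreeAlgebra isVariety 2
      α = collapse 0F 1F
      β = collapse 1F 2F
      γ = collapse 0F 2F

      middle : ∃[ m ] Congruence.rel (_∧ᶜ_ Free γ α) (var 0F) m ×
                      Congruence.rel (_∧ᶜ_ Free γ β) m (var 2F)
      middle with arithmetical Free free∈𝒱
      ... | distributive , permutable =
        Equivalence.to (permutable (_∧ᶜ_ Free γ α) (_∧ᶜ_ Free γ β))
          (proj₁ (IsDistributiveLattice.∧-distribˡ-∨ distributive γ α β)
            ( base (refl , refl)
            , trans (base (inj₁ (base (refl , refl)))) (base (inj₂ (base (refl , refl))))))

    separation : {A : Algebra 𝓛} → A ∈ 𝒱 → ∀ {u v} → ¬ (Algebra._≈_ A u v) →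
                 ∃[ θ ] A / θ ∈ FSI 𝒱 × ¬ Congruence.rel θ u v
    separation {A} A∈𝒱 u≉v with Separation.fsi-separation A u≉v
    ... | θ , irreducible , ¬θuv = θ , (variety-quotient isVariety A∈𝒱 θ , irreducible) , ¬θuv

    -- Two maps that differ at `b` still differ after composition with a separating quotient of `C`
    -- in `FSI 𝒱`.
    epic-FSI⇒epic : ∀ {B} {A : Subalgebra B} → IsEpicSubalgebra (FSI 𝒱) B A → IsEpicSubalgebra 𝒱 B A
    epic-FSI⇒epic epic C C∈𝒱 g g′ agree b = byContradiction λ gb≉g′b →
      let θ , C/θ∈FSI , ¬θ = separation C∈𝒱 gb≉g′b in
      ¬θ (epic (C / θ) C/θ∈FSI (projection θ ∘ʰ g) (projection θ ∘ʰ g′)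
            (λ a a∈A → Congruence.reflexive θ (agree a a∈A)) b)

    -- From total epic subalgebras in `FSI 𝒱` to those in `𝒱`.

    module _ (universal : IsUniversalClass (FSI 𝒱)) (total : EpicSubalgebrasTotal (FSI 𝒱))
             (B : Algebra 𝓛) (A : Subalgebra B)
             (A∈𝒱 : Subalgebra.algebra A ∈ 𝒱) (B∈𝒱 : B ∈ 𝒱) (epic : IsEpicSubalgebra 𝒱 B A) where
      private
        module B = Algebra B
        A′ = Subalgebra.algebra A
        module A′ = Algebra A′
      open Congruence
      open MajorityTerm majorityTerm

      Spec : Set (lsuc ℓ ⊔ κ)
      Spec = ∃[ θ ] B / θ ∈ FSI 𝒱

      module _ (θ : Congruence B) where
        module ≈θ = IsEquivalence (isEquivalence θ)

      -- The image of `A` in `B / θ` is again epic, because maps out of `B / θ` pull back to `B`; by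
      -- `total` it is all of `B / θ`.
      meets-classes : ((θ , _) : Spec) → ∀ b → ∃[ a ] rel θ (proj₁ a) b
      meets-classes (θ , B/θ∈FSI) = total (B / θ) A/θ (universal-sub universal A/θ B/θ∈FSI) B/θ∈FSI
        λ C C∈FSI g g′ agree → epic C (proj₁ C∈FSI) (g ∘ʰ projection θ) (g′ ∘ʰ projection θ)
          λ a a∈A → agree a ((a , a∈A) , ≈θ.refl θ)
        where
        A/θ : Subalgebra (B / θ)
        A/θ = image (projection θ ∘ʰ inclusion A)

      -- Sends `b` to its chosen `θ`-representative in `A`; equality and operations are respected
      -- modulo `θ`, hence modulo `γ`.
      representative : ((θ , _) : Spec) (γ : Congruence A′) →
        (∀ {x y} → rel θ (proj₁ x) (proj₁ y) → rel γ x y) → Hom B (A′ / γ)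
      representative s@(θ , _) γ θ⊆γ = record
        { func     = record
          { to   = to
          ; cong = λ {x} {y} x≈y → θ⊆γ (≈θ.trans θ (to-θ x)
              (≈θ.trans θ (reflexive θ x≈y) (≈θ.sym θ (to-θ y))))
          }
        ; preserve = λ f xs → θ⊆γ (≈θ.trans θ (to-θ _)
            (≈θ.sym θ (compatible θ f (λ i → to-θ (xs i)))))
        }
        where
        to : B.Carrier → A′.Carrier
        to = proj₁ ∘ meets-classes s
        to-θ : ∀ b → rel θ (proj₁ (to b)) b
        to-θ = proj₂ ∘ meets-classes s

      -- The maps B → B/θ ≅ A/θ → A/γ and B → B/θ′ ≅ A/θ′ → A/γ with γ = θ ∨ θ′ agree on A.
      pair-approximation : ((θ , _) (θ′ , _) : Spec) → ∀ b →
        ∃[ a ] rel θ (proj₁ a) b × rel θ′ (proj₁ a) b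
      pair-approximation s@(θ , _) s′@(θ′ , _) b =
        -- Permutability in `A` factors the join through `c`, which is `θ`-related to one
        -- representative of `b` and `θ′`-related to the other.
        let c , θac , θ′ca′ = Equivalence.to (proj₂ (arithmetical A′ A∈𝒱) θ↾ θ′↾) agree-at-b in
        c , ≈θ.trans θ (≈θ.sym θ θac) (proj₂ (meets-classes s b))
          , ≈θ.trans θ′ θ′ca′ (proj₂ (meets-classes s′ b))
        where
        θ↾ θ′↾ γ : Congruence A′
        θ↾  = comap (inclusion A) θ
        θ′↾ = comap (inclusion A) θ′
        γ   = _∨ᶜ_ A′ θ↾ θ′↾

        agree-at-b : rel γ (proj₁ (meets-classes s b)) (proj₁ (meets-classes s′ b))
        agree-at-b = epic (A′ / γ) (variety-quotient isVariety A∈𝒱 γ)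
          (representative s γ (base ∘ inj₁)) (representative s′ γ (base ∘ inj₂))
          (λ a a∈A → trans
            (base {x = proj₁ (meets-classes s a)} {y = a , a∈A} (inj₁ (proj₂ (meets-classes s a))))
            (base (inj₂ (≈θ.sym θ′ (proj₂ (meets-classes s′ a))))))
          b

      module _ (b : B.Carrier) where

        Agrees : A′.Carrier → Pred Spec ℓ
        Agrees a (θ , _) = rel θ (proj₁ a) b

        ApproximatedIn : List A′.Carrier → Pred (Spec × Spec) ℓ
        ApproximatedIn as (s , s′) = ∃[ a ] a ∈ˡ as × Agrees a s × Agrees a s′

        -- If every finite list as fails at some pair of congruences, then so does
        -- all of A at an ultraproduct of these pairs.
        compactness : ∃[ as ] ∀ ss → ApproximatedIn as ss
        compactness = byContradiction λ none → absurd λ as → ¬∀⇒∃¬ (none ∘ (as ,_))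
          where
          absurd : ¬ (∀ as → ∃[ ss ] ¬ ApproximatedIn as ss)
          absurd bad with ultrafilter tails (tails-isFilter {A = A′.Carrier})
          ... | U , filter , tails⊆U , ultra =
            -- Some list `as` contains `a` while `a` agrees with `b` at both congruences of the pair
            -- `bad as`: three large sets meet. This contradicts the choice of that pair.
            let a , Uθ , Uθ′ = pair-approximation (limit (proj₁ ∘ proj₁ ∘ bad))
                                                  (limit (proj₂ ∘ proj₁ ∘ bad)) b
                as , a∈as , agrees =
                  proper (meet {a ∈ˡ_} (tails⊆U (a ∷ [] , λ ⊆as → ⊆as (here refl)))
                    (meet {Agrees a ∘ proj₁ ∘ proj₁ ∘ bad} {Agrees a ∘ proj₂ ∘ proj₁ ∘ bad} Uθ Uθ′))
            in proj₂ (bad as) (a , a∈as , agrees)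
            where
            open IsFilter filter

            limit : (List A′.Carrier → Spec) → Spec
            limit s = Limit.limit (proj₁ ∘ s) filter ,
                      Limit.universal-limit (proj₁ ∘ s) filter ultra universal (proj₂ ∘ s)

        majority : A′.Carrier → A′.Carrier → A′.Carrier → A′.Carrier
        majority x y z = ⟦_⟧ A′ term (x Vector.∷ y Vector.∷ z Vector.∷ Vector.[])

        majority-quotient : ∀ θ ρ → rel θ (proj₁ (⟦_⟧ A′ term ρ)) (⟦_⟧ (B / θ) term (proj₁ ∘ ρ))
        majority-quotient θ ρ = reflexive θ
          (B.trans (⟦⟧-sub A term ρ) (B.sym (⟦⟧-quotient θ term (proj₁ ∘ ρ))))

        member-of-epic : b ∈ Subalgebra.member A
        member-of-epic =
          let as , covered = compactness
              a , agrees = bakerPixley Agrees majority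
                -- Two arguments congruent to `b` are congruent to each other, so the majority law
                -- in `B / θ` applies; the other two cases are alike.
                (λ {x} {y} {z} {(θ , B/θ∈FSI)} p q →
                  ≈θ.trans θ (majority-quotient θ _) (≈θ.trans θ (≈θ.sym θ
                    (maj-₁₂ (proj₁ B/θ∈FSI) _ (≈θ.trans θ p (≈θ.sym θ q)))) p))
                (λ {x} {y} {z} {(θ , B/θ∈FSI)} p q →
                  ≈θ.trans θ (majority-quotient θ _) (≈θ.trans θ (≈θ.sym θ
                    (maj-₁₃ (proj₁ B/θ∈FSI) _ (≈θ.trans θ p (≈θ.sym θ q)))) p))
                (λ {x} {y} {z} {(θ , B/θ∈FSI)} p q →
                  ≈θ.trans θ (majority-quotient θ _) (≈θ.trans θ
                    (maj-₂₃ (proj₁ B/θ∈FSI) _ (≈θ.trans θ p (≈θ.sym θ q))) q))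
                A′.nonempty as (λ s t → covered (s , t))
          in Subalgebra.respects A
               (byContradiction λ a≉b → let θ , B/θ∈FSI , ¬θ = separation B∈𝒱 a≉b in
                 ¬θ (agrees (θ , B/θ∈FSI)))
               (proj₂ a)

theorem14 :
    (∀ {a} → ExcludedMiddle a) →
    (∀ {a ℓ₁ b ℓ₂} → AxiomOfChoice a ℓ₁ b ℓ₂) →
    ∀ {ℓ κ : Level} (𝓛 : Signature ℓ) (𝒱 : Class 𝓛 κ) →
    IsVariety 𝒱 → IsArithmetical 𝒱 → IsUniversalClass (FSI 𝒱) →
    (HasSurjectiveEpis 𝒱 ⇔ EpicSubalgebrasTotal 𝒱) ×
    (EpicSubalgebrasTotal 𝒱 ⇔ EpicSubalgebrasTotal (FSI 𝒱)) ×
    (EpicSubalgebrasTotal (FSI 𝒱) ⇔ HasSurjectiveEpis (FSI 𝒱))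
theorem14 em ac 𝓛 𝒱 isVariety arithmetical universal =
  surjectiveEpis⇔epicSubalgebrasTotal (variety-sub isVariety) ,
  mk⇔ (λ total B A A∈FSI B∈FSI epic →
         total B A (proj₁ A∈FSI) (proj₁ B∈FSI) (epic-FSI⇒epic isVariety arithmetical {A = A} epic))
      (member-of-epic isVariety arithmetical universal) ,
  mk⇔ from to
  where
  open Classical em ac
  open Equivalence (surjectiveEpis⇔epicSubalgebrasTotal (universal-sub universal))
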